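{- Let $(\mathscr{P},\mathscr{B},\mathrm{I})$ be a linear space with incidence graph $\Gamma$, let $\varphi$ be a gain function on $\Gamma$ with gain group $G$ acting on the left on a nonempty set $\Lambda$. Then $\mathfrak{M}(\Gamma,\varphi)$ is a generalized quadrangle if and only if for every $p\in\mathscr{P}$ and $b\in\mathscr{B}$ with $p$ not incident with $b$, and every $\lambda\in\Lambda$, the function $\rho_{b,p,\lambda}:\mathscr{P}_b\to\Lambda$ is bijective. Moreover, when $\mathfrak{M}(\Gamma,\varphi)$ is a generalized quadrangle: (1) the set $X=\{x_p : p\in\mathscr{P}\}$ is an ovoid of $\mathfrak{M}(\Gamma,\varphi)$; (2) for every $b\in\mathscr{B}$ the set $\mathscr{P}_b$ has the same cardinality as $\Lambda$; hence $(\mathscr{P},\mathscr{B},\mathrm{I})$ is a Steiner system; (3) if $\mathscr{P}$ is finite, then $\Lambda$ is finite, $|\mathscr{P}|=v\ge 3$, $|\Lambda|=k\ge 2$, and in $\mathfrak{M}(\Gamma,\varphi)$ every line is incident with exactly $1+s$ points and every point is incident with exactly $1+t$ lines, where $s=\frac{v-1}{k-1}$ and $t=k-1$.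
   Context: An incidence structure is a triple $(\mathscr{P},\mathscr{B},\mathrm{I})$ where $\mathscr{P}$ (points) and $\mathscr{B}$ (lines) are nonempty disjoint sets and $\mathrm{I}\subseteq\mathscr{P}\times\mathscr{B}$ is a nonempty incidence relation; write $p\ \mathrm{I}\ b$ or $b\ \mathrm{I}\ p$ when $(p,b)\in\mathrm{I}$, and $\mathscr{P}_b=\{q\in\mathscr{P}: q\ \mathrm{I}\ b\}$. It is a linear space if any two distinct points are incident with exactly one common line, each line is incident with at least two points, and some point and line are not incident. A linear space is a Steiner system if all sets $\mathscr{P}_b$ have the same (possibly infinite) cardinality. The incidence graph $\Gamma$ is the bipartite graph with vertex set $\mathscr{P}\cup\mathscr{B}$ and an edge $bp$ for each incident pair; every edge is oriented from its line to its point. A gain function with gain group $G$ assigns to each edge $e$ an element $\varphi(e)\in G$ (extended to the free group on edges, so $\varphi(e^{ -1})=\varphi(e)^{ -1}$). For a walk $w=(u_0,e_1,u_1,\dots,e_n,u_n)$ in $\Gamma$, $\varphi_w=\varphi(e_n)^{\delta_n}\cdots\varphi(e_1)^{\delta_1}$ with $\delta_i=1$ if $e_i$ is oriented from $u_{i-1}$ to $u_i$ and $\delta_i=-1$ otherwise. For $b\in\mathscr{B}$, $p\in\mathscr{P}$ with $p$ not incident with $b$, define $\rho_{b,p}:\mathscr{P}_b\to G$ by $\rho_{b,p}(q)=\varphi_w$ where $w=(b,e_1,q,e_2,b',e_3,p)$ and $b'$ is the unique line incident with $p$ and $q$ (so $\rho_{b,p}(q)=\varphi(b'p)\varphi(b'q)^{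 -1}\varphi(bq)$); and for $\lambda\in\Lambda$ define $\rho_{b,p,\lambda}(q)=\rho_{b,p}(q)\cdot\lambda$. Construction $\mathfrak{M}(\Gamma,\varphi)$: the incidence structure whose points are the formal symbols $x_p$ ($p\in\mathscr{P}$) and $y_{b,\lambda}$ ($b\in\mathscr{B},\lambda\in\Lambda$), whose lines are the formal symbols $z_{p,\lambda}$ ($p\in\mathscr{P},\lambda\in\Lambda$), and whose incidences are exactly: $x_p$ incident with $z_{p,\lambda}$ for all $\lambda$, and $y_{b,\lambda}$ incident with $z_{p,\mu}$ whenever $b\ \mathrm{I}\ p$ and $\mu=\varphi(bp)\cdot\lambda$. A $k$-chain is a sequence $(u_0,\dots,u_k)$ of elements with $u_i$ incident with $u_{i-1}$; $d(u,v)$ is the least $k$ admitting a $k$-chain from $u$ to $v$. A generalized quadrangle is an incidence structure with $d(u,v)\le 4$ for all $u,v$ and a unique $k$-chain from $u$ to $v$ whenever $d(u,v)=k<4$. An ovoid of a generalized quadrangle is a set $O$ of points such that each line is incident with exactly one point of $O$. -}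

module Defs where

open import Algebra.Bundles using (Group)
open import Data.Nat.Base using (ℕ; zero; suc; _≤_; _<_)
open import Data.Product using (∃-syntax; ∃₂; ∃!; _×_; _,_; proj₁; proj₂)
open import Data.Sum.Base using (_⊎_; inj₁; inj₂)
open import Function.Bundles using (_⤖_)
open import Level using (Level; _⊔_) renaming (suc to lsuc)
open import Relation.Binary.Definitions using (Irrelevant)
open import Relation.Binary.PropositionalEquality.Core using (_≡_; _≢_; refl)
open import Relation.Nullary.Negation.Core using (¬_)
open import Relation.Unary using (Pred)

private
  variable
    a b i c ℓ l : Level

-- Incidence is proof-irrelevant, so it is a subset of Point × Line.
-- Points and lines are nonempty because the incidence relation is;
-- they are disjoint because they are separate types.
record IncidenceStructure (a b i : Level) : Set (lsuc (a ⊔ b ⊔ i)) where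
  infix 4 _I_ _~_
  infixr 5 _∷_
  field
    Point        : Set a
    Line         : Set b
    _I_          : Point → Line → Set i
    I-irrelevant : Irrelevant _I_
    I-nonempty   : ∃₂ _I_

  PointsOn : Line → Set (a ⊔ i)
  PointsOn m = ∃[ q ] q I m

  LinesThrough : Point → Set (b ⊔ i)
  LinesThrough q = ∃[ m ] q I m

  Element : Set (a ⊔ b)
  Element = Point ⊎ Line

  -- u ~ v is also the type of edges of the incidence graph, traversed
  -- from u to v: line→point follows the orientation, point→line goes against it.
  data _~_ : Element → Element → Set (a ⊔ b ⊔ i) where
    line→point : ∀ {p m} → p I m → inj₂ m ~ inj₁ p
    point→line : ∀ {p m} → p I m → inj₁ p ~ inj₂ m

  -- k-chains, which are the same as walks of length k in the incidence graph.
  -- By irrelevance of _I_, such a chain is determined by its sequence of elements.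
  data Chain : ℕ → Element → Element → Set (a ⊔ b ⊔ i) where
    []  : ∀ {u} → Chain zero u u
    _∷_ : ∀ {k u v w} → u ~ v → Chain k v w → Chain (suc k) u w

  -- d(u , v) = k
  IsDistance : Element → Element → ℕ → Set (a ⊔ b ⊔ i)
  IsDistance u v k = Chain k u v × (∀ j → j < k → ¬ Chain j u v)

  record IsGeneralizedQuadrangle : Set (a ⊔ b ⊔ i) where
    field
      distance≤4   : ∀ u v → ∃[ k ] (k ≤ 4 × IsDistance u v k)
      unique-chain : ∀ u v k → k < 4 → IsDistance u v k →
                     (γ δ : Chain k u v) → γ ≡ δ

  IsOvoid : Pred Point ℓ → Set (a ⊔ b ⊔ i ⊔ ℓ)
  IsOvoid O = ∀ m → ∃! _≡_ λ o → O o × o I m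

record LinearSpace (a b i : Level) : Set (lsuc (a ⊔ b ⊔ i)) where
  field
    incidenceStructure : IncidenceStructure a b i
  open IncidenceStructure incidenceStructure public
  field
    unique-line : ∀ p q → p ≢ q → ∃! _≡_ λ m → p I m × q I m
    two-points  : ∀ m → ∃₂ λ p q → p ≢ q × p I m × q I m
    nonincident : ∃₂ λ p m → ¬ p I m

IsSteiner : LinearSpace a b i → Set (a ⊔ b ⊔ i)
IsSteiner S = ∀ m n → PointsOn m ⤖ PointsOn n
  where open LinearSpace S

record LeftAction (G : Group c ℓ) (Λ : Set l) : Set (c ⊔ ℓ ⊔ l) where
  open Group G
  infixr 7 _·_
  field
    _·_        : Carrier → Λ → Λ
    ·-cong     : ∀ {g h} → g ≈ h → ∀ κ → g · κ ≡ h · κ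
    ·-identity : ∀ κ → ε · κ ≡ κ
    ·-assoc    : ∀ g h κ → (g ∙ h) · κ ≡ g · (h · κ)

-- The value on the edge joining p and m, oriented from m to p.
GainFunction : LinearSpace a b i → Group c ℓ → Set (a ⊔ b ⊔ i ⊔ c)
GainFunction S G = ∀ {p m} → p I m → Group.Carrier G
  where open LinearSpace S

module Gain (S : LinearSpace a b i) (G : Group c ℓ) (φ : GainFunction S G) where
  open LinearSpace S
  open Group G

  edgeGain : ∀ {u v} → u ~ v → Carrier
  edgeGain (line→point e) = φ e
  edgeGain (point→line e) = φ e ⁻¹

  walkGain : ∀ {k u v} → Chain k u v → Carrier
  walkGain []      = ε
  walkGain (e ∷ w) = walkGain w ∙ edgeGain e

  ρ : ∀ m p → ¬ p I m → PointsOn m → Carrier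
  ρ m p p∉m (q , q∈m) =
    walkGain (line→point q∈m ∷ point→line q∈n ∷ line→point p∈n ∷ [])
    where
    p≢q : p ≢ q
    p≢q refl = p∉m q∈m

    join = unique-line p q p≢q

    p∈n : p I proj₁ join
    p∈n = proj₁ (proj₁ (proj₂ join))

    q∈n : q I proj₁ join
    q∈n = proj₂ (proj₁ (proj₂ join))

module Construction
  (S : LinearSpace a b i) (G : Group c ℓ) (φ : GainFunction S G)
  {Λ : Set l} (act : LeftAction G Λ)
  where

  open LinearSpace S
  open LeftAction act
  open Gain S G φ

  ρΛ : ∀ m p → ¬ p I m → Λ → PointsOn m → Λ
  ρΛ m p p∉m κ q = ρ m p p∉m q · κ

  data 𝔐Point : Set (a ⊔ b ⊔ l) where
    x : Point → 𝔐Point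
    y : Line → Λ → 𝔐Point

  data 𝔐Line : Set (a ⊔ l) where
    z : Point → Λ → 𝔐Line

  data _𝔐I_ : 𝔐Point → 𝔐Line → Set (a ⊔ b ⊔ i ⊔ l) where
    x-z : ∀ {p κ} → x p 𝔐I z p κ
    y-z : ∀ {p m κ μ} (e : p I m) → μ ≡ φ e · κ → y m κ 𝔐I z p μ

  𝔐I-irrelevant : Irrelevant _𝔐I_
  𝔐I-irrelevant x-z        x-z           = refl
  𝔐I-irrelevant (y-z e eq) (y-z e′ eq′) with I-irrelevant e e′
  𝔐I-irrelevant (y-z e refl) (y-z .e refl) | refl = refl

  -- λ₀ witnesses that Λ is nonempty.
  𝔐 : (λ₀ : Λ) → IncidenceStructure (a ⊔ b ⊔ l) (a ⊔ l) (a ⊔ b ⊔ i ⊔ l)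
  𝔐 λ₀ = record
    { Point        = 𝔐Point
    ; Line         = 𝔐Line
    ; _I_          = _𝔐I_
    ; I-irrelevant = 𝔐I-irrelevant
    ; I-nonempty   = x (proj₁ I-nonempty) , z (proj₁ I-nonempty) λ₀ , x-z
    }

  X : Pred 𝔐Point (a ⊔ b ⊔ l)
  X o = ∃[ p ] o ≡ x p

-- A structure without isolated elements and with at most one line through two
-- points is a generalized quadrangle exactly when every antiflag (P , L) has a
-- unique projection: a 3-chain from P to L.  In 𝔐 projections exist and are
-- unique for free, except from y m κ to z p μ with p not on m.  There a 3-chain
-- passes through some z q (φ(mq) κ) with q on m and then through some y n ν with
-- n = pq, so that 3-chains correspond to the q with ρ(q) κ = μ.
-- For (3), the lines through p cover every point other than p once, and p once
-- per line.
module Submission where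

open import Defs
open import Algebra.Bundles using (Group)
open import Axiom.ExcludedMiddle using (ExcludedMiddle)
open import Data.Empty using (⊥-elim)
open import Data.Fin.Base using (Fin)
open import Data.Fin.Permutation using (↔⇒≡)
open import Data.Fin.Properties using (+↔⊎; *↔×; 1↔⊤; injective⇒≤)
open import Data.List.Base using (List; []; _∷_; length; lookup; tabulate; deduplicate)
open import Data.List.Membership.Propositional using (_∈_)
open import Data.List.Membership.Propositional.Properties
  using (∈-lookup; ∈-tabulate⁺; ∈-deduplicate⁺)
open import Data.List.Relation.Unary.All as All using ([]; _∷_)
open import Data.List.Relation.Unary.AllPairs using ([]; _∷_)
open import Data.List.Relation.Unary.Any using (index)
open import Data.List.Relation.Unary.Any.Properties using (lookup-index)
open import Data.List.Relation.Unary.Unique.DecPropositional.Properties using (deduplicate-!)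
open import Data.List.Relation.Unary.Unique.Propositional using (Unique)
open import Data.Nat.Base
  using (suc; _≤_; _<_; _+_; _*_; _∸_; z≤n; s≤s; >-nonZero)
open import Data.Nat.Induction using (<-rec)
open import Data.Nat.Properties
  using (≤-refl; ≤-trans; <⇒≤; ∸-monoˡ-≤; +-comm; *-distribˡ-∸; *-identityʳ; ∸-+-assoc;
         m+n∸n≡m; m+[n∸m]≡n; *-cancelʳ-≡)
open import Data.Product using (∃; ∃!; ∃₂; ∃-syntax; _×_; _,_; proj₁; proj₂; -,_)
open import Data.Product.Function.Dependent.Propositional using (Σ-↔)
open import Data.Sum.Base using (_⊎_; inj₁; inj₂)
open import Data.Sum.Function.Propositional using (_⊎-↔_)
open import Data.Unit.Base using (⊤; tt)
open import Function.Base using (_∘_)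
open import Function.Bundles using (_⇔_; _⤖_; _↔_; mk⇔; mk⤖; mk↔ₛ′; module Bijection; module Inverse)
open import Function.Construct.Composition using (_⤖-∘_; _↔-∘_)
open import Function.Definitions using (Bijective; Injective; StrictlySurjective)
open import Function.Properties.Bijection using (⤖⇒↔)
open import Function.Properties.Inverse using (↔⇒⤖; ↔-sym)
open import Level using (Level; _⊔_; Lift; lift; lower)
open import Relation.Binary.Definitions using (DecidableEquality)
open import Relation.Binary.PropositionalEquality
  using (_≡_; _≢_; refl; sym; trans; cong; subst; module ≡-Reasoning)
open import Relation.Nullary.Decidable.Core using (Dec; yes; no; map′)
open import Relation.Nullary.Negation.Core using (¬_; contradiction)

private
  variable
    a b i c ℓ l α β : Level
    A : Set α
    B : Set β

-- Excluded middle at lower levels, and finite types.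

-- Excluded middle is assumed once, at a join of levels; a smaller proposition is decided through
-- its lift.
lower-em : ∀ α β → ExcludedMiddle (α ⊔ β) → ExcludedMiddle α
lower-em α β em {P} = map′ lower lift (em {Lift β P})

lookup-injective : {xs : List A} → Unique xs → Injective _≡_ _≡_ (lookup xs)
lookup-injective (_ ∷ _)    {Fin.zero}  {Fin.zero}  _  = refl
lookup-injective (x≢xs ∷ _) {Fin.zero}  {Fin.suc j} eq = contradiction eq (All.lookup x≢xs (∈-lookup j))
lookup-injective (x≢xs ∷ _) {Fin.suc i} {Fin.zero}  eq = contradiction (sym eq) (All.lookup x≢xs (∈-lookup i))
lookup-injective (_ ∷ xs!)  {Fin.suc i} {Fin.suc j} eq = cong Fin.suc (lookup-injective xs! eq)

-- Positions in a repetition-free list inject into `Fin n`. Explicit lists of points then give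
-- `3 ≤ v` and `2 ≤ k`.
unique-length≤ : ∀ {n} → A ⤖ Fin n → {xs : List A} → Unique xs → length xs ≤ n
unique-length≤ A⤖Fin xs! =
  injective⇒≤ (lookup-injective xs! ∘ Bijection.injective A⤖Fin)

-- Listing the values of `f` without repetition exhausts `B`, and the position in that list is the
-- bijection.
surjection⇒finite : DecidableEquality B → ∀ {n} → A ⤖ Fin n →
                    (f : A → B) → StrictlySurjective _≡_ f → ∃ λ k → B ⤖ Fin k
surjection⇒finite {B = B} _≟_ A⤖Fin f f-surj =
  length image , ↔⇒⤖ (mk↔ₛ′ (index ∘ ∈image) (lookup image) index-lookup lookup-∈)
  where
  A↔Fin = ⤖⇒↔ A⤖Fin

  image : List B
  image = deduplicate _≟_ (tabulate (f ∘ Inverse.from A↔Fin))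

  f∈image : ∀ x → f x ∈ image
  f∈image x = ∈-deduplicate⁺ _≟_
    (subst (λ y → f y ∈ tabulate (f ∘ Inverse.from A↔Fin))
      (Inverse.strictlyInverseʳ A↔Fin x) (∈-tabulate⁺ (Inverse.to A↔Fin x)))

  ∈image : ∀ y → y ∈ image
  ∈image y = subst (_∈ image) (proj₂ (f-surj y)) (f∈image _)

  lookup-∈ : ∀ y → lookup image (index (∈image y)) ≡ y
  lookup-∈ y = sym (lookup-index (∈image y))

  index-lookup : ∀ j → index (∈image (lookup image j)) ≡ j
  index-lookup j = lookup-injective {xs = image} (deduplicate-! _≟_ _) (lookup-∈ _)

-- Generalized quadrangles and unique projections.

module _ (𝕀 : IncidenceStructure a b i) where
  open IncidenceStructure 𝕀

  Projection : Point → Line → Line × Point → Set i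
  Projection p m (n , q) = p I n × q I n × q I m

  HasProjections : Set (a ⊔ b ⊔ i)
  HasProjections = ∀ p m → ¬ p I m → ∃! _≡_ (Projection p m)

  projectionChain : ∀ {p m n q} → Projection p m (n , q) → Chain 3 (inj₁ p) (inj₂ m)
  projectionChain (p∈n , q∈n , q∈m) =
    point→line p∈n ∷ line→point q∈n ∷ point→line q∈m ∷ []

  snoc : ∀ {k u v w} → Chain k u v → v ~ w → Chain (suc k) u w
  snoc []      f = f ∷ []
  snoc (e ∷ γ) f = e ∷ snoc γ f

  flip : ∀ {u v} → u ~ v → v ~ u
  flip (line→point e) = point→line e
  flip (point→line e) = line→point e

  reverse : ∀ {k u v} → Chain k u v → Chain k v u
  reverse []      = []
  reverse (e ∷ γ) = snoc (reverse γ) (flip e)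

  -- Chains alternate between points and lines, so one from a point to a line has odd length, and
  -- length 1 would be an incidence.
  antiflag-distance : ∀ {p m} → ¬ p I m → Chain 3 (inj₁ p) (inj₂ m) →
                      IsDistance (inj₁ p) (inj₂ m) 3
  antiflag-distance {p} {m} p∉m γ = γ , shorter
    where
    shorter : ∀ j → j < 3 → ¬ Chain j (inj₁ p) (inj₂ m)
    shorter 1 _ (point→line p∈m ∷ [])            = p∉m p∈m
    shorter 2 _ (point→line _ ∷ (() ∷ []))
    shorter (suc (suc (suc _))) (s≤s (s≤s (s≤s ())))

  -- By parity the bound 4 leaves only distance 3 for an antiflag, where chains are unique.
  GQ⇒projections : IsGeneralizedQuadrangle → HasProjections
  GQ⇒projections gq p m p∉m with IsGeneralizedQuadrangle.distance≤4 gq (inj₁ p) (inj₂ m)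
  ... | 1 , _ , point→line p∈m ∷ [] , _ = ⊥-elim (p∉m p∈m)
  ... | 2 , _ , point→line _ ∷ (() ∷ []) , _
  ... | 4 , _ , point→line _ ∷ line→point _ ∷ point→line _ ∷ (() ∷ []) , _
  ... | suc (suc (suc (suc (suc _)))) , s≤s (s≤s (s≤s (s≤s ()))) , _
  ... | 3 , _ , γ@(point→line p∈n ∷ line→point q∈n ∷ point→line q∈m ∷ []) , _ =
    -, (p∈n , q∈n , q∈m) , λ π → same-elements π
      (IsGeneralizedQuadrangle.unique-chain gq _ _ 3 ≤-refl
        (antiflag-distance p∉m γ) γ (projectionChain π))
    where
    same-elements : ∀ {x} (π : Projection p m x) → γ ≡ projectionChain π → _ ≡ x
    same-elements π refl = refl

  module _
    (em : ExcludedMiddle (a ⊔ b ⊔ i))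
    (line-through : ∀ p → LinesThrough p)
    (point-on : ∀ m → PointsOn m)
    (line-unique : ∀ {p q m n} → p ≢ q → p I m → q I m → p I n → q I n → m ≡ n)
    (project : HasProjections)
    where

    -- Descent on the length: either a strictly shorter chain exists, or the present one realises
    -- the distance.
    distance≤ : ∀ {u v} k → Chain k u v → ∃[ j ] (j ≤ k × IsDistance u v j)
    distance≤ {u} {v} = <-rec _ λ k shorten γ → minimise k shorten γ em
      where
      minimise : ∀ k → (∀ {k′} → k′ < k → Chain k′ u v → ∃[ j ] (j ≤ k′ × IsDistance u v j)) →
                Chain k u v → Dec (∃[ j ] (j < k × Chain j u v)) →
                ∃[ j ] (j ≤ k × IsDistance u v j)
      minimise k shorten γ (yes (k′ , k′<k , γ′)) with shorten k′<k γ′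
      ... | j , j≤k′ , d = j , ≤-trans j≤k′ (<⇒≤ k′<k) , d
      minimise k shorten γ (no ∄) = k , ≤-refl , γ , λ j j<k δ → ∄ (j , j<k , δ)

    chain-point-line : ∀ p m → ∃[ k ] (k ≤ 3 × Chain k (inj₁ p) (inj₂ m))
    chain-point-line p m with lower-em i (a ⊔ b ⊔ i) em {p I m}
    ... | yes p∈m = 1 , s≤s z≤n , point→line p∈m ∷ []
    ... | no p∉m  = 3 , ≤-refl , projectionChain (proj₁ (proj₂ (project p m p∉m)))

    -- A point and a line are within 3. For two elements of the same kind, one step to an incident
    -- element reduces to that case.
    chain≤4 : ∀ u v → ∃[ k ] (k ≤ 4 × Chain k u v)
    chain≤4 (inj₁ p) (inj₁ q) with line-through q
    ... | m , q∈m with chain-point-line p m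
    ...   | k , k≤3 , γ = suc k , s≤s k≤3 , snoc γ (line→point q∈m)
    chain≤4 (inj₁ p) (inj₂ m) with chain-point-line p m
    ... | k , k≤3 , γ = k , ≤-trans k≤3 (s≤s (s≤s (s≤s z≤n))) , γ
    chain≤4 (inj₂ m) (inj₁ p) with chain-point-line p m
    ... | k , k≤3 , γ = k , ≤-trans k≤3 (s≤s (s≤s (s≤s z≤n))) , reverse γ
    chain≤4 (inj₂ m) (inj₂ n) with point-on m
    ... | p , p∈m with chain-point-line p n
    ...   | k , k≤3 , γ = suc k , s≤s k≤3 , line→point p∈m ∷ γ

    -- Length 2 rests on `line-unique`, length 3 on uniqueness of projections, read in either
    -- direction. Minimality of `k` supplies the distinctness or non-incidence that these require.
    unique-chain′ : ∀ u v k → k < 4 → IsDistance u v k → (γ δ : Chain k u v) → γ ≡ δ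
    unique-chain′ u .u 0 _ _ [] [] = refl
    unique-chain′ _ _ 1 _ _ (line→point e ∷ []) (line→point e′ ∷ [])
      rewrite I-irrelevant e e′ = refl
    unique-chain′ _ _ 1 _ _ (point→line e ∷ []) (point→line e′ ∷ [])
      rewrite I-irrelevant e e′ = refl
    unique-chain′ (inj₁ p) (inj₁ q) 2 _ (_ , shorter)
      (point→line p∈m ∷ line→point q∈m ∷ []) (point→line p∈n ∷ line→point q∈n ∷ [])
      with line-unique (λ { refl → shorter 0 (s≤s z≤n) [] }) p∈m q∈m p∈n q∈n
    ... | refl rewrite I-irrelevant p∈m p∈n | I-irrelevant q∈m q∈n = refl
    unique-chain′ (inj₂ m) (inj₂ n) 2 _ (_ , shorter)
      (line→point {p} p∈m ∷ point→line p∈n ∷ []) (line→point {q} q∈m ∷ point→line q∈n ∷ [])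
      with lower-em a (a ⊔ b ⊔ i) em {p ≡ q}
    ... | yes refl rewrite I-irrelevant p∈m q∈m | I-irrelevant p∈n q∈n = refl
    -- Two distinct common points would make `m` and `n` equal, hence at distance 0.
    ... | no p≢q with line-unique p≢q p∈m q∈m p∈n q∈n
    ...   | refl = ⊥-elim (shorter 0 (s≤s z≤n) [])
    unique-chain′ (inj₁ p) (inj₂ m) 3 _ (_ , shorter)
      (point→line e₁ ∷ line→point e₂ ∷ point→line e₃ ∷ [])
      (point→line f₁ ∷ line→point f₂ ∷ point→line f₃ ∷ [])
      with project p m (λ p∈m → shorter 1 (s≤s (s≤s z≤n)) (point→line p∈m ∷ []))
    ... | _ , _ , unique with unique (e₁ , e₂ , e₃) | unique (f₁ , f₂ , f₃)
    ...   | refl | refl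
      rewrite I-irrelevant e₁ f₁ | I-irrelevant e₂ f₂ | I-irrelevant e₃ f₃ = refl
    unique-chain′ (inj₂ m) (inj₁ p) 3 _ (_ , shorter)
      (line→point e₃ ∷ point→line e₂ ∷ line→point e₁ ∷ [])
      (line→point f₃ ∷ point→line f₂ ∷ line→point f₁ ∷ [])
      with project p m (λ p∈m → shorter 1 (s≤s (s≤s z≤n)) (line→point p∈m ∷ []))
    ... | _ , _ , unique with unique (e₁ , e₂ , e₃) | unique (f₁ , f₂ , f₃)
    ...   | refl | refl
      rewrite I-irrelevant e₁ f₁ | I-irrelevant e₂ f₂ | I-irrelevant e₃ f₃ = refl
    unique-chain′ (inj₁ _) (inj₁ _) 3 _ _ (point→line _ ∷ line→point _ ∷ (() ∷ []))
    unique-chain′ (inj₂ _) (inj₂ _) 3 _ _ (line→point _ ∷ point→line _ ∷ (() ∷ []))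
    unique-chain′ _ _ (suc (suc (suc (suc _)))) (s≤s (s≤s (s≤s (s≤s ()))))

    projections⇒GQ : IsGeneralizedQuadrangle
    projections⇒GQ = record
      { distance≤4   = distance≤4
      ; unique-chain = unique-chain′
      }
      where
      distance≤4 : ∀ u v → ∃[ k ] (k ≤ 4 × IsDistance u v k)
      distance≤4 u v with chain≤4 u v
      ... | k , k≤4 , γ with distance≤ k γ
      ...   | j , j≤k , d = j , ≤-trans j≤k k≤4 , d

-- Group elements act invertibly.

module _ {G : Group c ℓ} {Λ : Set l} (act : LeftAction G Λ) where
  open Group G using (_⁻¹; inverseˡ; inverseʳ)
  open LeftAction act

  ⁻¹·-cancel : ∀ g κ → g ⁻¹ · (g · κ) ≡ κ
  ⁻¹·-cancel g κ =
    trans (sym (·-assoc (g ⁻¹) g κ)) (trans (·-cong (inverseˡ g) κ) (·-identity κ))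

  ·⁻¹-cancel : ∀ g κ → g · (g ⁻¹ · κ) ≡ κ
  ·⁻¹-cancel g κ =
    trans (sym (·-assoc g (g ⁻¹) κ)) (trans (·-cong (inverseʳ g) κ) (·-identity κ))

  ·-cancelˡ : ∀ g {κ μ} → g · κ ≡ g · μ → κ ≡ μ
  ·-cancelˡ g {κ} {μ} eq =
    trans (sym (⁻¹·-cancel g κ)) (trans (cong (g ⁻¹ ·_) eq) (⁻¹·-cancel g μ))

-- Points and lines of a linear space.

module _ (S : LinearSpace a b i) where
  open LinearSpace S

  line-unique : ∀ {p q m n} → p ≢ q → p I m → q I m → p I n → q I n → m ≡ n
  line-unique {p} {q} p≢q p∈m q∈m p∈n q∈n with unique-line p q p≢q
  ... | _ , _ , unique = trans (sym (unique (p∈m , q∈m))) (unique (p∈n , q∈n))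

  PointsOn-≡ : ∀ {m} {x y : PointsOn m} → proj₁ x ≡ proj₁ y → x ≡ y
  PointsOn-≡ refl = cong -,_ (I-irrelevant _ _)

  LinesThrough-≡ : ∀ {p} {x y : LinesThrough p} → proj₁ x ≡ proj₁ y → x ≡ y
  LinesThrough-≡ refl = cong -,_ (I-irrelevant _ _)

  module _ (em : ExcludedMiddle (a ⊔ b ⊔ i)) where

    _≟ₚ_ : DecidableEquality Point
    p ≟ₚ q = lower-em a (a ⊔ b ⊔ i) em

    _I?_ : ∀ p m → Dec (p I m)
    p I? m = lower-em i (a ⊔ b ⊔ i) em

    -- The given antiflag serves unless its point lies on `m`. Then its line has a point off `m`,
    -- since two points in common with `m` would make the lines equal.
    point-off : ∀ m → ∃[ p ] ¬ p I m
    point-off m with nonincident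
    ... | p₀ , m₀ , p₀∉m₀ with p₀ I? m
    ...   | no p₀∉m = p₀ , p₀∉m
    ...   | yes p₀∈m with two-points m₀
    ...     | q , r , q≢r , q∈m₀ , r∈m₀ with q I? m | r I? m
    ...       | no q∉m  | _       = q , q∉m
    ...       | yes _   | no r∉m  = r , r∉m
    ...       | yes q∈m | yes r∈m =
      ⊥-elim (p₀∉m₀ (subst (p₀ I_) (line-unique q≢r q∈m r∈m q∈m₀ r∈m₀) p₀∈m))

    other-point : ∀ p → ∃[ q ] p ≢ q
    other-point p with two-points (proj₁ (proj₂ I-nonempty))
    ... | q , r , q≢r , _ with p ≟ₚ q
    ...   | no p≢q   = q , p≢q
    ...   | yes refl = r , q≢r

    line-through : ∀ p → LinesThrough p
    line-through p with other-point p
    ... | q , p≢q with unique-line p q p≢q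
    ...   | m , (p∈m , _) , _ = m , p∈m

    -- Finite linear spaces and the count of lines through a point.

    module _ {v} (Point⤖Fin : Point ⤖ Fin v) where

      3≤v : 3 ≤ v
      3≤v with nonincident
      ... | _ , m , _ with point-off m | two-points m
      ...   | p , p∉m | q , r , q≢r , q∈m , r∈m = unique-length≤ Point⤖Fin {p ∷ q ∷ r ∷ []}
        (((λ { refl → p∉m q∈m }) ∷ (λ { refl → p∉m r∈m }) ∷ []) ∷ (q≢r ∷ []) ∷ [] ∷ [])

      -- Sending the points off `m` to a base point maps `Point` onto the points of `m`.
      PointsOn-finite : ∀ m → ∃ λ k → PointsOn m ⤖ Fin k
      PointsOn-finite m = surjection⇒finite (λ _ _ → lower-em (a ⊔ i) (a ⊔ b ⊔ i) em) Point⤖Fin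
        retract retract-surj
        where
        base : PointsOn m
        base with two-points m
        ... | q , _ , _ , q∈m , _ = q , q∈m

        retract : Point → PointsOn m
        retract q with q I? m
        ... | yes q∈m = q , q∈m
        ... | no _    = base

        retract-surj : StrictlySurjective _≡_ retract
        retract-surj (q , q∈m) = q , eq
          where
          eq : retract q ≡ (q , q∈m)
          eq with q I? m
          ... | yes _  = PointsOn-≡ refl
          ... | no q∉m = ⊥-elim (q∉m q∈m)

      2≤PointsOn : ∀ {m k} → PointsOn m ⤖ Fin k → 2 ≤ k
      2≤PointsOn {m} PointsOn⤖Fin with two-points m
      ... | q , r , q≢r , q∈m , r∈m =
        unique-length≤ PointsOn⤖Fin {(q , q∈m) ∷ (r , r∈m) ∷ []}
          (((λ { refl → q≢r refl }) ∷ []) ∷ [] ∷ [])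

    -- The default `n` is the value at `q = p`, where two points do not determine a line.
    joinOr : ∀ p → LinesThrough p → ∀ q → LinesThrough p
    joinOr p n q with p ≟ₚ q
    ... | yes _  = n
    ... | no p≢q with unique-line p q p≢q
    ...   | m , (p∈m , _) , _ = m , p∈m

    -- Every line through `p` has a second point and is the join of `p` with it.
    LinesThrough-finite : ∀ {v} → Point ⤖ Fin v → ∀ p → ∃ λ r → LinesThrough p ⤖ Fin r
    LinesThrough-finite Point⤖Fin p = surjection⇒finite
      (λ _ _ → lower-em (b ⊔ i) (a ⊔ b ⊔ i) em) Point⤖Fin (joinOr p base) surj
      where
      base = line-through p

      joinOr-on : ∀ {q m} (p∈m : p I m) → p ≢ q → q I m → joinOr p base q ≡ (m , p∈m)
      joinOr-on {q} p∈m p≢q q∈m with p ≟ₚ q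
      ... | yes p≡q = ⊥-elim (p≢q p≡q)
      ... | no p≢q  = LinesThrough-≡ (proj₂ (proj₂ (unique-line p q p≢q)) (p∈m , q∈m))

      surj : StrictlySurjective _≡_ (joinOr p base)
      surj (m , p∈m) with two-points m
      ... | q , r , q≢r , q∈m , r∈m with p ≟ₚ q
      ...   | no p≢q   = q , joinOr-on p∈m p≢q q∈m
      ...   | yes refl = r , joinOr-on p∈m q≢r r∈m

    -- The second point may be `p` itself, so the fibre over each line is all of `PointsOn`.
    Flag : Point → Set (a ⊔ b ⊔ i)
    Flag p = ∃ λ (n : LinesThrough p) → PointsOn (proj₁ n)

    -- Point ⊎ LinesThrough p, instead of deleting p from Point and from the lines
    -- through it, so that the count v + r = 1 + r k needs no subtraction.
    pencil : ∀ p → (Point ⊎ LinesThrough p) ↔ (⊤ ⊎ Flag p)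
    pencil p = mk↔ₛ′ to from to∘from from∘to
      where
      to : Point ⊎ LinesThrough p → ⊤ ⊎ Flag p
      -- The extra copy of each line accounts for the flag of `p` on it; the point `p` itself goes
      -- to `⊤`.
      to (inj₂ (n , p∈n)) = inj₂ ((n , p∈n) , p , p∈n)
      to (inj₁ q) with p ≟ₚ q
      ... | yes _  = inj₁ tt
      ... | no p≢q with unique-line p q p≢q
      ...   | n , (p∈n , q∈n) , _ = inj₂ ((n , p∈n) , q , q∈n)

      from : ⊤ ⊎ Flag p → Point ⊎ LinesThrough p
      from (inj₁ _) = inj₁ p
      from (inj₂ (n , q , _)) with p ≟ₚ q
      ... | yes _ = inj₂ n
      ... | no _  = inj₁ q

      Flag-≡ : ∀ {n n′ q} {p∈n : p I n} {p∈n′ : p I n′} {q∈n : q I n} {q∈n′ : q I n′} →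
               n ≡ n′ → _≡_ {A = Flag p} ((n , p∈n) , q , q∈n) ((n′ , p∈n′) , q , q∈n′)
      Flag-≡ {p∈n = p∈n} {p∈n′} {q∈n} {q∈n′} refl
        rewrite I-irrelevant p∈n p∈n′ | I-irrelevant q∈n q∈n′ = refl

      to∘from : ∀ y → to (from y) ≡ y
      to∘from (inj₁ tt) with p ≟ₚ p
      ... | yes _  = refl
      ... | no p≢p = ⊥-elim (p≢p refl)
      to∘from (inj₂ ((n , p∈n) , q , q∈n)) with p ≟ₚ q in eq
      ... | yes refl = cong inj₂ (Flag-≡ refl)
      ... | no p≢q rewrite eq with unique-line p q p≢q
      ...   | m , _ , unique = cong inj₂ (Flag-≡ (unique (p∈n , q∈n)))

      from∘to : ∀ y → from (to y) ≡ y
      from∘to (inj₂ (n , p∈n)) with p ≟ₚ p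
      ... | yes _  = refl
      ... | no p≢p = ⊥-elim (p≢p refl)
      from∘to (inj₁ q) with p ≟ₚ q in eq
      ... | yes refl = refl
      ... | no p≢q with unique-line p q p≢q
      ...   | _ rewrite eq = refl

    -- The two sides of `pencil` have sizes `v + r` and `1 + r * k`; subtracting `suc r` from both
    -- leaves the claim.
    pencil-count : ∀ {v k r} p → Point ⤖ Fin v → (∀ m → PointsOn m ⤖ Fin k) →
                   LinesThrough p ⤖ Fin r → r * (k ∸ 1) ≡ v ∸ 1
    pencil-count {v} {k} {r} p Point⤖Fin PointsOn⤖Fin Lines⤖Fin = begin
      r * (k ∸ 1)      ≡⟨ *-distribˡ-∸ r k 1 ⟩
      r * k ∸ r * 1    ≡⟨ cong (r * k ∸_) (*-identityʳ r) ⟩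
      r * k ∸ r        ≡⟨⟩
      1 + r * k ∸ suc r ≡⟨ cong (_∸ suc r) (sym v+r≡1+rk) ⟩
      v + r ∸ suc r    ≡⟨ cong (v + r ∸_) (+-comm 1 r) ⟩
      v + r ∸ (r + 1)  ≡⟨ sym (∸-+-assoc (v + r) r 1) ⟩
      v + r ∸ r ∸ 1    ≡⟨ cong (_∸ 1) (m+n∸n≡m v r) ⟩
      v ∸ 1            ∎
      where
      open ≡-Reasoning

      Flag↔ : Flag p ↔ Fin (r * k)
      Flag↔ = ↔-sym *↔× ↔-∘ Σ-↔ (⤖⇒↔ Lines⤖Fin) (λ {n} → ⤖⇒↔ (PointsOn⤖Fin (proj₁ n)))

      v+r≡1+rk : v + r ≡ 1 + r * k
      v+r≡1+rk = ↔⇒≡ (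
        ↔-sym +↔⊎ ↔-∘ ((↔-sym 1↔⊤ ⊎-↔ Flag↔) ↔-∘ (pencil p ↔-∘
        ((↔-sym (⤖⇒↔ Point⤖Fin) ⊎-↔ ↔-sym (⤖⇒↔ Lines⤖Fin)) ↔-∘ +↔⊎))))

-- The structure `𝔐`: projections and the bijectivity of `ρΛ`.

module _
  (S : LinearSpace a b i) (G : Group c ℓ) (φ : GainFunction S G)
  {Λ : Set l} (λ₀ : Λ) (act : LeftAction G Λ)
  where

  open LinearSpace S
  open Group G using (_⁻¹; ε; _∙_; identityˡ)
  open LeftAction act
  open Construction S G φ act

  private
    module M = IncidenceStructure (𝔐 λ₀)

  -- The gain takes an incidence proof as argument; by irrelevance its value depends only on the
  -- edge.
  φ-subst : ∀ {p m} (e f : p I m) {κ} → φ e · κ ≡ φ f · κ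
  φ-subst e f rewrite I-irrelevant e f = refl

  φ-cancel : ∀ {p m} (e f : p I m) {κ μ} → φ e · κ ≡ φ f · μ → κ ≡ μ
  φ-cancel e f eq = ·-cancelˡ act (φ e) (trans eq (φ-subst f e))

  -- The value of ρΛ at q is the label at p of the line through p and q,
  -- once that line is labelled consistently with m at q.
  ρΛ≡ : ∀ {p m n q} (p∉m : ¬ p I m) (q∈m : q I m) (p∈n : p I n) (q∈n : q I n) {κ ν} →
        φ q∈m · κ ≡ φ q∈n · ν → ρΛ m p p∉m κ (q , q∈m) ≡ φ p∈n · ν
  ρΛ≡ {p} {m} {n} {q} p∉m q∈m p∈n q∈n {κ} {ν} eq =
    along (unique-line p q λ { refl → p∉m q∈m })
    where
    open ≡-Reasoning

    -- The walk gain is written out over an arbitrary join `J`, so that its line can be matched with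
    -- `n`.
    along : (J : ∃! _≡_ λ n → p I n × q I n) →
            (((ε ∙ φ (proj₁ (proj₁ (proj₂ J)))) ∙ φ (proj₂ (proj₁ (proj₂ J))) ⁻¹) ∙ φ q∈m) · κ
              ≡ φ p∈n · ν
    along (n′ , (p∈n′ , q∈n′) , unique) with unique (p∈n , q∈n)
    ... | refl = begin
      (((ε ∙ φ p∈n′) ∙ φ q∈n′ ⁻¹) ∙ φ q∈m) · κ  ≡⟨ ·-assoc _ _ κ ⟩
      ((ε ∙ φ p∈n′) ∙ φ q∈n′ ⁻¹) · (φ q∈m · κ)  ≡⟨ ·-assoc _ _ _ ⟩
      (ε ∙ φ p∈n′) · (φ q∈n′ ⁻¹ · (φ q∈m · κ))  ≡⟨ ·-cong (identityˡ _) _ ⟩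
      φ p∈n′ · (φ q∈n′ ⁻¹ · (φ q∈m · κ))        ≡⟨ φ-subst p∈n′ p∈n ⟩
      φ p∈n · (φ q∈n′ ⁻¹ · (φ q∈m · κ))
        ≡⟨ cong (λ μ → φ p∈n · (φ q∈n′ ⁻¹ · μ)) (trans eq (φ-subst q∈n q∈n′)) ⟩
      φ p∈n · (φ q∈n′ ⁻¹ · (φ q∈n′ · ν))        ≡⟨ cong (φ p∈n ·_) (⁻¹·-cancel act (φ q∈n′) ν) ⟩
      φ p∈n · ν                                 ∎

  -- The walk from `m` via `q` and the join of `p` and `q` to `p` lifts to a 3-chain starting at
  -- `y m κ`. The gains force its labels, and the last one is the value of `ρΛ` at `q`.
  ρΛ⇒projection : ∀ {p m κ μ} (p∉m : ¬ p I m) (q : PointsOn m) → ρΛ m p p∉m κ q ≡ μ →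
    ∃₂ λ n ν → Projection (𝔐 λ₀) (y m κ) (z p μ) (z (proj₁ q) (φ (proj₂ q) · κ) , y n ν)
  ρΛ⇒projection {p} {m} {κ} p∉m (q , q∈m) eq
    with unique-line p q (λ { refl → p∉m q∈m })
  ... | n , (p∈n , q∈n) , _ =
    n , φ q∈n ⁻¹ · (φ q∈m · κ) ,
    y-z q∈m refl ,
    y-z q∈n (sym (·⁻¹-cancel act (φ q∈n) _)) ,
    y-z p∈n (trans (sym eq) (ρΛ≡ p∉m q∈m p∈n q∈n (sym (·⁻¹-cancel act (φ q∈n) _))))

  -- Projections from `y m κ` to `z p μ` correspond to preimages of `μ`: uniqueness gives
  -- injectivity, existence surjectivity.
  GQ⇒bijective : M.IsGeneralizedQuadrangle →
                 ∀ p m → (p∉m : ¬ p I m) → ∀ κ → Bijective _≡_ _≡_ (ρΛ m p p∉m κ)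
  GQ⇒bijective gq p m p∉m κ = injective , surjective
    where
    project : ∀ μ → ∃! _≡_ (Projection (𝔐 λ₀) (y m κ) (z p μ))
    project μ = GQ⇒projections (𝔐 λ₀) gq (y m κ) (z p μ) λ { (y-z p∈m _) → p∉m p∈m }

    z-injective : ∀ {q r ξ ζ Q R} → _≡_ {A = 𝔐Line × 𝔐Point} (z q ξ , Q) (z r ζ , R) → q ≡ r
    z-injective refl = refl

    injective : Injective _≡_ _≡_ (ρΛ m p p∉m κ)
    injective {q} {r} eq
      with ρΛ⇒projection p∉m q eq | ρΛ⇒projection p∉m r refl
    ... | _ , _ , π | _ , _ , π′ with project (ρΛ m p p∉m κ r)
    ...   | _ , _ , unique = PointsOn-≡ S (z-injective (trans (sym (unique π)) (unique π′)))

    surjective : ∀ μ → ∃ λ q → ∀ {r} → r ≡ q → ρΛ m p p∉m κ r ≡ μ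
    surjective μ with project μ
    -- A projection through `x p` would use a line `z p _` incident with `y m κ`, putting `p` on
    -- `m`.
    ... | _ , (y-z p∈m _ , x-z , x-z) , _ = contradiction p∈m p∉m
    ... | _ , (y-z q∈m refl , y-z q∈n eq , y-z p∈n eq′) , _ =
      (_ , q∈m) , λ { refl → trans (ρΛ≡ p∉m q∈m p∈n q∈n eq) (sym eq′) }

  module _ (em : ExcludedMiddle (a ⊔ b ⊔ i)) where

    -- From `x p` the projection runs through the join of `p` and `q`, with labels computed back
    -- from `μ`. From `y m κ` it runs through `x p` if `p` is on `m`, and otherwise through the
    -- preimage of `μ` under `ρΛ`.
    bijective⇒projections :
      (∀ p m → (p∉m : ¬ p I m) → ∀ κ → Bijective _≡_ _≡_ (ρΛ m p p∉m κ)) →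
      HasProjections (𝔐 λ₀)
    bijective⇒projections bij (x p) (z q μ) p≁q
      with unique-line p q (λ { refl → p≁q x-z })
    ... | n , (p∈n , q∈n) , unique =
      (z p (φ p∈n · (φ q∈n ⁻¹ · μ)) , y n (φ q∈n ⁻¹ · μ)) ,
      (x-z , y-z p∈n refl , y-z q∈n (sym (·⁻¹-cancel act (φ q∈n) μ))) ,
      unique′
      where
      unique′ : ∀ {π} → Projection (𝔐 λ₀) (x p) (z q μ) π → _ ≡ π
      unique′ (x-z , x-z , x-z) = contradiction x-z p≁q
      unique′ (x-z , y-z p∈n′ refl , y-z q∈n′ refl) with unique (p∈n′ , q∈n′)
      ... | refl rewrite I-irrelevant p∈n′ p∈n | I-irrelevant q∈n′ q∈n
        = cong (λ ν → z p (φ p∈n · ν) , y n ν) (⁻¹·-cancel act (φ q∈n) _)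
    bijective⇒projections bij (y m κ) (z p μ) m≁p with _I?_ S em p m
    ... | yes p∈m = (z p (φ p∈m · κ) , x p) , (y-z p∈m refl , x-z , x-z) , unique
      where
      unique : ∀ {π} → Projection (𝔐 λ₀) (y m κ) (z p μ) π → (z p (φ p∈m · κ) , x p) ≡ π
      unique (y-z e refl , x-z , x-z) = cong (λ ξ → z p ξ , x p) (φ-subst p∈m e)
      -- A detour through `y n ν` would make `y m κ` incident with `z p μ`: if `q` is `p`, the two
      -- labels at `p` agree; otherwise `n` is `m`, and `ν` is `κ`.
      unique (y-z {q} q∈m refl , y-z q∈n eq , y-z p∈n eq′) with _≟ₚ_ S em p q
      ... | yes refl = contradiction (y-z q∈m (trans eq′ (trans (φ-subst p∈n q∈n) (sym eq)))) m≁p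
      ... | no p≢q with line-unique S p≢q p∈m q∈m p∈n q∈n
      ...   | refl with φ-cancel q∈m q∈n eq
      ...     | refl = contradiction (y-z p∈n eq′) m≁p
    ... | no p∉m with proj₂ (bij p m p∉m κ) μ
    ...   | (q , q∈m) , ρΛ-q with ρΛ⇒projection p∉m (q , q∈m) (ρΛ-q refl)
    ...     | n , ν , π@(_ , y-z q∈n eq , y-z p∈n _) = _ , π , unique
      where
      unique : ∀ {π} → Projection (𝔐 λ₀) (y m κ) (z p μ) π → (z q (φ q∈m · κ) , y n ν) ≡ π
      unique (y-z p∈m _ , x-z , x-z) = contradiction p∈m p∉m
      -- Any projection computes `ρΛ` at its own point of `m`, so injectivity identifies that point
      -- with `q`; line and label follow.
      unique (y-z r∈m refl , y-z r∈n eq′ , y-z p∈n′ μ≡)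
        with proj₁ (bij p m p∉m κ) (trans (ρΛ-q refl) (trans μ≡ (sym (ρΛ≡ p∉m r∈m p∈n′ r∈n eq′))))
      ... | refl with line-unique S (λ { refl → p∉m q∈m }) p∈n q∈n p∈n′ r∈n
      ...   | refl with φ-cancel q∈n r∈n (trans (sym eq) eq′)
      ...     | refl = refl

  module _ (em : ExcludedMiddle (a ⊔ b ⊔ i ⊔ l)) where

    private
      em-S : ExcludedMiddle (a ⊔ b ⊔ i)
      em-S = lower-em (a ⊔ b ⊔ i) l em

    bijective⇒GQ :
      (∀ p m → (p∉m : ¬ p I m) → ∀ κ → Bijective _≡_ _≡_ (ρΛ m p p∉m κ)) →
      M.IsGeneralizedQuadrangle
    bijective⇒GQ bij = projections⇒GQ (𝔐 λ₀) em through on (λ {P} → joined {P})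
      (bijective⇒projections em-S bij)
      where
      through : ∀ Q → M.LinesThrough Q
      through (x p)   = z p λ₀ , x-z
      through (y m κ) with two-points m
      ... | q , _ , _ , q∈m , _ = z q (φ q∈m · κ) , y-z q∈m refl

      on : ∀ n → M.PointsOn n
      on (z p κ) = x p , x-z

      joined : ∀ {P Q m n} → P ≢ Q → P 𝔐I m → Q 𝔐I m → P 𝔐I n → Q 𝔐I n → m ≡ n
      joined P≢Q x-z x-z _ _ = contradiction refl P≢Q
      joined P≢Q x-z (y-z e refl) x-z (y-z f refl) = cong (z _) (φ-subst e f)
      joined P≢Q (y-z e refl) x-z (y-z f refl) x-z = cong (z _) (φ-subst e f)
      joined P≢Q (y-z {p} p∈m refl) (y-z p∈n eq) (y-z {q} q∈m refl) (y-z q∈n eq′)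
        with _≟ₚ_ S em-S p q
      ... | yes refl = cong (z p) (φ-subst p∈m q∈m)
      -- Common lines `z p _` and `z q _` place both points on the join of `p` and `q` with the same
      -- label, so `P` and `Q` coincide.
      ... | no p≢q with line-unique S p≢q p∈m q∈m p∈n q∈n
      ...   | refl = contradiction (cong (y _) (φ-cancel p∈m p∈n eq)) P≢Q

    -- The bijection is `ρΛ` for some point off `m`, with starting label `λ₀`.
    GQ⇒PointsOn⤖Λ : M.IsGeneralizedQuadrangle → ∀ m → PointsOn m ⤖ Λ
    GQ⇒PointsOn⤖Λ gq m with point-off S em-S m
    ... | p , p∉m = mk⤖ (GQ⇒bijective gq p m p∉m λ₀)

  -- The ovoid, and the local sizes in `𝔐`.

  X-ovoid : M.IsOvoid X
  X-ovoid (z p κ) = x p , ((p , refl) , x-z) , λ { ((_ , refl) , x-z) → refl }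

  -- Each line `m` through `p` admits exactly one label, `φ p∈m ⁻¹ · μ`. The summand `⊤` is `x p`
  -- and becomes the 1 in `1 + s`.
  PointsOn-z : ∀ p μ → (⊤ ⊎ LinesThrough p) ↔ M.PointsOn (z p μ)
  PointsOn-z p μ = mk↔ₛ′ to from to∘from from∘to
    where
    to : ⊤ ⊎ LinesThrough p → M.PointsOn (z p μ)
    to (inj₁ tt)        = x p , x-z
    to (inj₂ (m , p∈m)) = y m (φ p∈m ⁻¹ · μ) , y-z p∈m (sym (·⁻¹-cancel act (φ p∈m) μ))

    from : M.PointsOn (z p μ) → ⊤ ⊎ LinesThrough p
    from (_ , x-z)       = inj₁ tt
    from (_ , y-z p∈m _) = inj₂ (_ , p∈m)

    y-≡ : ∀ {m κ ν} {e : y m κ 𝔐I z p μ} {f : y m ν 𝔐I z p μ} →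
          κ ≡ ν → _≡_ {A = M.PointsOn (z p μ)} (y m κ , e) (y m ν , f)
    y-≡ refl = cong -,_ (𝔐I-irrelevant _ _)

    to∘from : ∀ Q → to (from Q) ≡ Q
    to∘from (_ , x-z)          = refl
    to∘from (_ , y-z p∈m refl) = y-≡ (⁻¹·-cancel act (φ p∈m) _)

    from∘to : ∀ m → from (to m) ≡ m
    from∘to (inj₁ tt) = refl
    from∘to (inj₂ _)  = refl

  LinesThrough-x : ∀ p → Λ ↔ M.LinesThrough (x p)
  LinesThrough-x p = mk↔ₛ′ (λ κ → z p κ , x-z) (λ { (z _ κ , x-z) → κ })
    (λ { (z _ κ , x-z) → refl }) (λ _ → refl)

  LinesThrough-y : ∀ m κ → PointsOn m ↔ M.LinesThrough (y m κ)
  LinesThrough-y m κ = mk↔ₛ′ (λ { (q , q∈m) → z q (φ q∈m · κ) , y-z q∈m refl })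
    (λ { (z q _ , y-z q∈m _) → q , q∈m }) (λ { (z _ _ , y-z _ refl) → refl }) (λ { (_ , _) → refl })

-- The equivalence, and the parameters in the finite case.

theorem5 :
  ∀ {a b i c ℓ l} → ExcludedMiddle (a ⊔ b ⊔ i ⊔ l) →
  (S : LinearSpace a b i) (G : Group c ℓ) (φ : GainFunction S G)
  {Λ : Set l} (λ₀ : Λ) (act : LeftAction G Λ) →
  let open LinearSpace S
      open Construction S G φ act
      module M = IncidenceStructure (𝔐 λ₀)
  in
  (M.IsGeneralizedQuadrangle ⇔
    (∀ p m → (p∉m : ¬ p I m) → ∀ κ → Bijective _≡_ _≡_ (ρΛ m p p∉m κ)))
  ×
  (M.IsGeneralizedQuadrangle →
    M.IsOvoid X
    ×
    ((∀ m → PointsOn m ⤖ Λ) × IsSteiner S)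
    ×
    (∀ v → Point ⤖ Fin v →
      ∃ λ k → Λ ⤖ Fin k × 3 ≤ v × 2 ≤ k ×
      ∃₂ λ s t → s * (k ∸ 1) ≡ v ∸ 1 × t ≡ k ∸ 1 ×
        (∀ n → M.PointsOn n ⤖ Fin (1 + s)) ×
        (∀ q → M.LinesThrough q ⤖ Fin (1 + t))))
theorem5 {a} {b} {i} {l = l} em S G φ {Λ} λ₀ act =
  mk⇔ (GQ⇒bijective S G φ λ₀ act) (bijective⇒GQ S G φ λ₀ act em) ,
  λ gq → X-ovoid S G φ λ₀ act , (PointsOn⤖Λ gq , steiner gq) , finite gq
  where
  open LinearSpace S
  open Construction S G φ act
  module M = IncidenceStructure (𝔐 λ₀)

  em-S : ExcludedMiddle (a ⊔ b ⊔ i)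
  em-S = lower-em (a ⊔ b ⊔ i) l em

  PointsOn⤖Λ : M.IsGeneralizedQuadrangle → ∀ m → PointsOn m ⤖ Λ
  PointsOn⤖Λ = GQ⇒PointsOn⤖Λ S G φ λ₀ act em

  steiner : M.IsGeneralizedQuadrangle → IsSteiner S
  steiner gq m n = ↔⇒⤖ (↔-sym (⤖⇒↔ (PointsOn⤖Λ gq n))) ⤖-∘ PointsOn⤖Λ gq m

  finite : M.IsGeneralizedQuadrangle → ∀ v → Point ⤖ Fin v →
    ∃ λ k → Λ ⤖ Fin k × 3 ≤ v × 2 ≤ k ×
    ∃₂ λ s t → s * (k ∸ 1) ≡ v ∸ 1 × t ≡ k ∸ 1 ×
      (∀ n → M.PointsOn n ⤖ Fin (1 + s)) ×
      (∀ q → M.LinesThrough q ⤖ Fin (1 + t))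
  finite gq v Point⤖Fin with nonincident
  -- The parameters are read off at one line and one point: `k` counts the points on `m₀`, and `s`
  -- the lines through `p₀`.
  ... | p₀ , m₀ , _ with PointsOn-finite S em-S Point⤖Fin m₀ | LinesThrough-finite S em-S Point⤖Fin p₀
  ...   | k , PointsOn⤖Fin | s , Lines⤖Fin =
    k , Λ⤖Fin , 3≤v S em-S Point⤖Fin , 2≤k , s , k ∸ 1 ,
    pencil-count S em-S p₀ Point⤖Fin line-size Lines⤖Fin , refl ,
    points-size , lines-size
    where
    Λ⤖Fin : Λ ⤖ Fin k
    Λ⤖Fin = PointsOn⤖Fin ⤖-∘ ↔⇒⤖ (↔-sym (⤖⇒↔ (PointsOn⤖Λ gq m₀)))

    line-size : ∀ m → PointsOn m ⤖ Fin k
    line-size m = Λ⤖Fin ⤖-∘ PointsOn⤖Λ gq m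

    2≤k : 2 ≤ k
    2≤k = 2≤PointsOn S em-S Point⤖Fin PointsOn⤖Fin

    points-size : ∀ n → M.PointsOn n ⤖ Fin (1 + s)
    points-size (z p μ) with LinesThrough-finite S em-S Point⤖Fin p
    ... | r , Lines⤖Fin-p = subst (λ r → M.PointsOn (z p μ) ⤖ Fin (1 + r)) r≡s (↔⇒⤖
      (↔-sym +↔⊎ ↔-∘ ((↔-sym 1↔⊤ ⊎-↔ ⤖⇒↔ Lines⤖Fin-p) ↔-∘ ↔-sym (PointsOn-z S G φ λ₀ act p μ))))
      where
      -- Both numbers multiplied by `k ∸ 1` give `v ∸ 1`, and `k ∸ 1` is positive.
      r≡s : r ≡ s
      r≡s = *-cancelʳ-≡ r s (k ∸ 1) ⦃ >-nonZero (∸-monoˡ-≤ 1 2≤k) ⦄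
        (trans (pencil-count S em-S p Point⤖Fin line-size Lines⤖Fin-p)
          (sym (pencil-count S em-S p₀ Point⤖Fin line-size Lines⤖Fin)))

    -- As `t` is `k ∸ 1` and `k` is positive, `1 + t` is `k`.
    k-sized : ∀ {α} {A : Set α} → A ⤖ Fin k → A ⤖ Fin (1 + (k ∸ 1))
    k-sized {A = A} = subst (λ n → A ⤖ Fin n) (sym (m+[n∸m]≡n (<⇒≤ 2≤k)))

    lines-size : ∀ Q → M.LinesThrough Q ⤖ Fin (1 + (k ∸ 1))
    lines-size (x p)   =
      k-sized (Λ⤖Fin ⤖-∘ ↔⇒⤖ (↔-sym (LinesThrough-x S G φ λ₀ act p)))
    lines-size (y m κ) =
      k-sized (line-size m ⤖-∘ ↔⇒⤖ (↔-sym (LinesThrough-y S G φ λ₀ act m κ)))
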